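{- Let $G$ be a maximal outerplanar graph of order $n \ge 5$ and let $n_2$ be the number of vertices of $G$ of degree $2$. Then $\iota_1(G) \le \frac{n+n_2}{6}$ if $n_2 \le \frac{n}{3}$, and $\iota_1(G) \le \frac{n-n_2}{3}$ otherwise.
   Context: A maximal outerplanar graph (mop) is a simple graph that can be embedded in the plane so that all vertices lie on the boundary of the exterior (unbounded) face and every interior face is a triangle. For a graph $G$ and $S \subseteq V(G)$, $N_G[S]$ denotes the closed neighborhood of $S$ (the vertices of $S$ together with all vertices adjacent to some vertex of $S$). A set $S \subseteq V(G)$ is a $K_{1,2}$-isolating set of $G$ if $G - N_G[S]$ contains no copy of $K_{1,2}$ (i.e. no path on three vertices as a subgraph), equivalently every component of $G - N_G[S]$ has at most two vertices. $\iota_1(G)$ denotes the minimum size of a $K_{1,2}$-isolating set of $G$. -}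

module Defs where

open import Data.Nat using (ℕ; _<_; _⊓_; _⊔_)
open import Data.Fin using (Fin; toℕ)
open import Data.Fin.Subset using (Subset; _∈_; _∉_; ∣_∣)
open import Data.Vec using (tabulate)
open import Data.Bool using (Bool; true; false)
open import Data.Product using (Σ; _×_; ∃; ∃-syntax)
open import Data.Sum using (_⊎_)
open import Relation.Nullary using (¬_)
open import Relation.Binary.PropositionalEquality using (_≡_; _≢_)
open import Function.Definitions using (Injective)

record Graph (n : ℕ) : Set where
  field
    adj   : Fin n → Fin n → Bool
    sym   : ∀ u v → adj u v ≡ adj v u
    irrfl : ∀ v → adj v v ≡ false

open Graph public

Adj : ∀ {n} → Graph n → Fin n → Fin n → Set
Adj G u v = adj G u v ≡ true

deg : ∀ {n} → Graph n → Fin n → ℕ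
deg G v = ∣ tabulate (adj G v) ∣

isDeg2 : ℕ → Bool
isDeg2 2 = true
isDeg2 _ = false

n₂ : ∀ {n} → Graph n → ℕ
n₂ G = ∣ tabulate (λ v → isDeg2 (deg G v)) ∣

-- Maximal outerplanar graphs, combinatorially: G is a triangulation of a
-- convex polygon.  The vertices are placed (by a bijection pos) at the
-- corners 0,1,…,n-1 of a convex polygon in cyclic order; every side of the
-- polygon is an edge, no two edges cross, and the set of edges is maximal
-- non-crossing (every non-adjacent distinct pair crosses some edge), i.e.
-- all interior faces are triangles.

Between : ℕ → ℕ → ℕ → Set
Between a b x = (a ⊓ b) < x × x < (a ⊔ b)

Outside : ℕ → ℕ → ℕ → Set
Outside a b x = x < (a ⊓ b) ⊎ (a ⊔ b) < x

-- the chords ab and cd of a convex polygon (corners labelled in cyclic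
-- order by naturals) cross in their interiors
Cross : ℕ → ℕ → ℕ → ℕ → Set
Cross a b c d = (Between a b c × Outside a b d) ⊎ (Outside a b c × Between a b d)

Side : (n : ℕ) → ℕ → ℕ → Set
Side n i j = Data.Nat.suc i ≡ j ⊎ Data.Nat.suc j ≡ i
           ⊎ (i ≡ 0 × Data.Nat.suc j ≡ n) ⊎ (j ≡ 0 × Data.Nat.suc i ≡ n)
  where import Data.Nat

IsMOP : ∀ {n} → Graph n → Set
IsMOP {n} G =
  Σ (Fin n → Fin n) λ pos → (Injective _≡_ _≡_ pos ×
    let p : Fin n → ℕ
        p v = toℕ (pos v)
    in
    (∀ u v → Side n (p u) (p v) → Adj G u v) ×
    (∀ u v x y → Adj G u v → Adj G x y → ¬ Cross (p u) (p v) (p x) (p y)) ×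
    (∀ u v → u ≢ v → ¬ Adj G u v →
       ∃[ x ] ∃[ y ] (Adj G x y × Cross (p u) (p v) (p x) (p y))))

InN : ∀ {n} → Graph n → Subset n → Fin n → Set
InN G S v = v ∈ S ⊎ ∃[ s ] (s ∈ S × Adj G s v)

IsK12Isolating : ∀ {n} → Graph n → Subset n → Set
IsK12Isolating G S =
  ∀ u v w → u ≢ w → Adj G u v → Adj G v w →
    ¬ (¬ InN G S u × ¬ InN G S v × ¬ InN G S w)

{-# OPTIONS --safe #-}
-- A triangulated polygon is a binary tree of chords.  Along this tree we build
-- m vertex sets simultaneously (m = 6 for the first bound, m = 3 for the
-- second).  The apex of a triangle enters w of the sets, where w = 1 unless the
-- apex has degree 2, in which case w = 2 for m = 6 and w = 0 for m = 3; hence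
-- the sizes add up to n + n₂, respectively n - n₂.  What the other side of a
-- chord needs to know about one set is a pair of states, one for each end of
-- the chord, and 8, respectively 3, lists of m such pairs suffice: these
-- profiles are closed under gluing two pieces along a triangle, and across the
-- last chord they always close up to m isolating sets.  Both facts are finite
-- checks, done by computation.  The smallest of the m sets proves the bound.
module Submission where

open import Defs
open import Data.Nat using (ℕ; _≤_; _≥_; _>_; _*_; _+_)
open import Data.Product using (_×_; ∃-syntax)
open import Data.Fin.Subset using (∣_∣)

open import Data.Bool using (Bool; true; false; T; _∧_; _∨_; not; if_then_else_)
import Data.Bool.Properties as Bool
open import Data.Empty using (⊥-elim)
open import Data.Fin using (Fin; zero; suc; toℕ; punchOut)
open import Data.Fin.Patterns
open import Data.Fin.Permutation using (Permutation; permutation)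
open import Data.Fin.Properties as Fin
  using (toℕ<n; toℕ-injective; toℕ-fromℕ<; toℕ-inject₁; toℕ-fromℕ; punchOut-injective; injective⇒≤)
open import Data.Fin.Subset using (Subset; ⁅_⁆; ⊥; inside; outside)
  renaming (_∈_ to _∈ₛ_; _⊆_ to _⊆ₛ_; _∪_ to _∪ₛ_)
open import Data.Fin.Subset.Properties
  using (∣⊥∣≡0; ∣⁅x⁆∣≡1; x∈⁅x⁆; p⊆q⇒∣p∣≤∣q∣; p⊆p∪q; q⊆p∪q; x∈p⇒∣p-x∣<∣p∣; x∈p∧x≢y⇒x∈p-y)
open import Data.List using (List; []; _∷_; _++_; [_]; length; map; replicate; foldr)
open import Data.List.Membership.Propositional using (_∈_; find)
open import Data.List.Membership.Propositional.Properties using (∈-++⁻; ∈-++⁺ˡ; ∈-++⁺ʳ; ∈-map⁻)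
open import Data.List.Properties using (length-++)
open import Data.List.Relation.Unary.All using (All; []; _∷_; all?)
open import Data.List.Relation.Unary.Any using (Any; here; there; any?; satisfied)
open import Data.Nat using (zero; suc; _<_; _≤ᵇ_; _≤?_; _<?_; _≟_; z≤n; s≤s; s≤s⁻¹)
open import Data.Nat.DivMod using (_mod_; m<n⇒m%n≡m)
open import Data.Nat.ListAction using (sum)
open import Data.Nat.Properties
open import Data.Nat.Solver using (module +-*-Solver)
open import Data.Product using (_,_; proj₁; proj₂; map₂)
open import Data.Sum using (_⊎_; inj₁; inj₂; [_,_]′)
open import Data.Unit using (⊤; tt)
open import Data.Vec using (tabulate; []; _∷_)
open import Data.Vec.Properties using (lookup∘tabulate; lookup⇒[]=; []=⇒lookup)
open import Algebra.Properties.CommutativeMonoid.Sum +-0-commutativeMonoid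
  using (sum-permute; sum-init-last; sum-cong-≗) renaming (sum to sumᶠ)
open import Function using (_∘_)
open import Function.Bundles using (Equivalence)
open import Function.Definitions using (Injective)
open import Level using (0ℓ)
open import Relation.Binary.Definitions using (tri<; tri≈; tri>)
open import Relation.Binary.PropositionalEquality
  using (_≡_; _≢_; refl; trans; cong; cong₂; subst; subst₂) renaming (sym to ≡-sym)
open import Relation.Nullary using (¬_; Dec; yes; no; contradiction)
open import Relation.Nullary.Decidable using (toWitness; _×-dec_; _→-dec_)
open import Relation.Unary using (Pred; _∪_; _⊆_)

-- Sets of naturals with at most one element.

-- Few 0 is empty, Few 1 is at most one element, and larger bounds say nothing.
Few : ℕ → Pred ℕ 0ℓ → Set
Few 0             X = ∀ y → ¬ X y
Few 1             X = ∀ y z → X y → X z → y ≡ z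
Few (suc (suc _)) X = ⊤

few-⊆ : ∀ a {X Y} → Y ⊆ X → Few a X → Few a Y
few-⊆ 0             Y⊆X few = λ y y∈ → few y (Y⊆X y∈)
few-⊆ 1             Y⊆X few = λ y z y∈ z∈ → few y z (Y⊆X y∈) (Y⊆X z∈)
few-⊆ (suc (suc _)) Y⊆X few = tt

few-≤ : ∀ {a b X} → a ≤ b → Few a X → Few b X
few-≤ {b = 0}             z≤n       few = few
few-≤ {b = 1}             z≤n       few = λ y z y∈ _ → ⊥-elim (few y y∈)
few-≤ {b = 1}             (s≤s z≤n) few = few
few-≤ {b = suc (suc _)}   _         _   = tt

few-∪ : ∀ a b {X Y} → Few a X → Few b Y → Few (a + b) (X ∪ Y)
few-∪ 0             b fX fY = few-⊆ b (λ { {y} → [ (λ x → ⊥-elim (fX y x)) , (λ y∈ → y∈) ]′ }) fY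
few-∪ 1             0 fX fY = few-⊆ 1 (λ { {y} → [ (λ x → x) , (λ y∈ → ⊥-elim (fY y y∈)) ]′ }) fX
few-∪ 1             (suc b) fX fY = tt
few-∪ (suc (suc _)) b fX fY = tt

-- States at the ends of a chord; gluing and closing conditions.

-- The state of the end x of a chord, with respect to a set S on one side of it:
-- dominated means that S dominates x; lonely and paired that otherwise x has no,
-- respectively at most one, undominated neighbour strictly on that side;
-- promised assumes that x is dominated from elsewhere, and chosen that x itself
-- is in the set (it is then paid for elsewhere).  Each state is weaker than the
-- one before.
data State : Set where
  dominated lonely paired promised chosen : State

isDominated isPromised isChosen : State → Bool
isDominated dominated = true
isDominated _         = false
isPromised promised = true
isPromised _        = false
isChosen chosen = true
isChosen _      = false

-- The value 2 sets no limit, as `Few 2` always holds: a promised or chosen end is assumed to be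
-- dominated. A dominated end can have 0 because its bound is asked for only when it is undominated.
cap : State → ℕ
cap dominated = 0
cap lonely    = 0
cap paired    = 1
cap promised  = 2
cap chosen    = 2

tally : Bool → ℕ
tally true  = 0
tally false = 1

few-tally : ∀ {d} {U : Pred ℕ 0ℓ} {x} → (T d → ¬ U x) → Few (tally d) (λ y → U y × y ≡ x)
few-tally {true}  known y (Uy , refl) = known tt Uy
few-tally {false} known y z (_ , refl) (_ , refl) = refl

Ends : Set
Ends = State × State

-- Whether the assumption that a part makes about an end is met: `killed` records that the end is in
-- the set, `safe` that it is known to be dominated.
permits : State → Bool → Bool → Bool
permits s killed safe = (not (isChosen s) ∨ killed) ∧ (not (isPromised s) ∨ safe)

-- Seen from the larger chord, an end gains only the apex as a possible undominated neighbour, hence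
-- `cap s′ + tally safeₖ`.
endOK : State → State → Bool → Bool → Bool
endOK s s′ safe safeₖ = safe ∨ (not (isDominated s) ∧ (cap s′ + tally safeₖ ≤ᵇ cap s))

-- Whether chords ik in state (s₁ , t₁) and kj in state (s₂ , t₂) yield the chord
-- ij in state (s , t), where b says whether the apex k is put into the set.
-- The e's are domination facts available before those of the two parts, which
-- keeps the discharge of promises from being circular; the d's include the latter.
glueable : Ends → Ends → Bool → Ends → Bool
glueable (s₁ , t₁) (s₂ , t₂) b (s , t) =
  permits s₁ (isChosen s) eᵢ ∧ permits t₂ (isChosen t) eⱼ ∧
  permits t₁ b (isDominated s₂ ∨ eₖ) ∧ permits s₂ b (isDominated t₁ ∨ eₖ) ∧
  -- After gluing, the apex is strictly inside the chord, so this settles it for good: its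
  -- neighbours lie inside the two parts or are the ends `i` and `j`.
  (dₖ ∨ (cap t₁ + cap s₂ + (tally dᵢ + tally dⱼ) ≤ᵇ 1)) ∧
  endOK s s₁ dᵢ dₖ ∧ endOK t t₂ dⱼ dₖ
  where
  eᵢ = isChosen s ∨ isPromised s ∨ b ∨ isChosen t
  eⱼ = isChosen t ∨ isPromised t ∨ b ∨ isChosen s
  eₖ = b ∨ isChosen s ∨ isChosen t
  dᵢ = isDominated s₁ ∨ eᵢ
  dⱼ = isDominated t₂ ∨ eⱼ
  dₖ = isDominated t₁ ∨ isDominated s₂ ∨ eₖ

insert : Bool → ℕ → List ℕ
insert true  k = k ∷ []
insert false k = []

-- The same for an edge with nothing on its other side.
closable : Ends → Bool
closable (s , t) =
  permits s (isChosen s) e ∧ permits t (isChosen t) e ∧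
  (dᵢ ∨ (cap s + tally dⱼ ≤ᵇ 1)) ∧ (dⱼ ∨ (cap t + tally dᵢ ≤ᵇ 1))
  where
  e = isChosen s ∨ isChosen t
  dᵢ = isDominated s ∨ e
  dⱼ = isDominated t ∨ e

closing : ℕ → ℕ → Ends → List ℕ
closing i j (s , t) = insert (isChosen s) i ++ insert (isChosen t) j

∧-split : ∀ {x y} → T (x ∧ y) → T x × T y
∧-split = Equivalence.to Bool.T-∧

∨-split : ∀ {x y} → T (x ∨ y) → T x ⊎ T y
∨-split = Equivalence.to Bool.T-∨

∨-elim : ∀ {x y} {C : Set} → (T x → C) → (T y → C) → T (x ∨ y) → C
∨-elim f g = [ f , g ]′ ∘ ∨-split

not-∨ : ∀ {x y} → T (not x ∨ y) → T x → T y
not-∨ {true} p _ = p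

-- Matching of profiles, and schemes.

-- The last element comes first: the searches below succeed quickly only in this order.
picks : ∀ {A : Set} → List A → List (A × List A)
picks []       = []
picks (x ∷ xs) = map (λ (y , ys) → y , x ∷ ys) (picks xs) ++ [ x , xs ]

-- The sets of two parts can be paired so as to glue to the given goals; the
-- Boolean of a goal says whether the apex enters that set.
Match : List Ends → List Ends → List (Bool × Ends) → Set
Match τ₁ τ₂ []             = ⊤
Match τ₁ τ₂ ((b , e) ∷ gs) =
  Any (λ (e₁ , τ₁′) → Any (λ (e₂ , τ₂′) → T (glueable e₁ e₂ b e) × Match τ₁′ τ₂′ gs) (picks τ₂)) (picks τ₁)

match? : ∀ τ₁ τ₂ gs → Dec (Match τ₁ τ₂ gs)
match? τ₁ τ₂ []             = yes tt
match? τ₁ τ₂ ((b , e) ∷ gs) =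
  any? (λ (e₁ , τ₁′) → any? (λ (e₂ , τ₂′) → Bool.T? (glueable e₁ e₂ b e) ×-dec match? τ₁′ τ₂′ gs) (picks τ₂)) (picks τ₁)

-- The apex always enters the leading sets. Containing a common neighbour of both ends, these can be
-- `DD`, so profiles list `DD` first.
flag : ℕ → List Ends → List (Bool × Ends)
flag w       []      = []
flag zero    (e ∷ τ) = (false , e) ∷ flag zero τ
flag (suc w) (e ∷ τ) = (true , e) ∷ flag w τ

map-proj₂-flag : ∀ w τ → map proj₂ (flag w τ) ≡ τ
map-proj₂-flag w       []      = refl
map-proj₂-flag zero    (e ∷ τ) = cong (e ∷_) (map-proj₂-flag zero τ)
map-proj₂-flag (suc w) (e ∷ τ) = cong (e ∷_) (map-proj₂-flag w τ)

bit : Bool → ℕ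
bit true  = 1
bit false = 0

flags : List (Bool × Ends) → ℕ
flags = sum ∘ map (bit ∘ proj₁)

flags-flag : ∀ w τ → flags (flag w τ) ≤ w
flags-flag w       []      = z≤n
flags-flag zero    (e ∷ τ) = flags-flag zero τ
flags-flag (suc w) (e ∷ τ) = s≤s (flags-flag w τ)

chosenEnds : Ends → ℕ
chosenEnds (s , t) = bit (isChosen s) + bit (isChosen t)

isSide : ∀ {n} → Fin (suc n) → Bool
isSide zero    = true
isSide (suc _) = false

weight : ℕ → Bool → ℕ
weight a b = if b then a else 1

-- τ is a final profile for m sets: l and r say whether the chords from the apex
-- to the two ends of the closing edge are sides, i.e. whether those ends have degree 2.
Closes : ℕ → ℕ → List Ends → List Ends → Bool → Bool → List Ends → Set
Closes m a τ₁ τ₂ l r τ =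
  length τ ≡ m × All (T ∘ closable) τ × sum (map chosenEnds τ) ≤ weight a l + weight a r ×
  Match τ₁ τ₂ (flag (weight a (l ∧ r)) τ)

closes? : ∀ m a τ₁ τ₂ l r τ → Dec (Closes m a τ₁ τ₂ l r τ)
closes? m a τ₁ τ₂ l r τ = (length τ ≟ m) ×-dec all? (Bool.T? ∘ closable) τ ×-dec
  (sum (map chosenEnds τ) ≤? weight a l + weight a r) ×-dec match? τ₁ τ₂ (flag (weight a (l ∧ r)) τ)

-- There are suc classes sets, and profile zero is that of a side of the polygon.
-- Since profile suc (next l r) belongs to a triangle, next returns a predecessor.
record Scheme : Set where
  field
    {classes types leafWeight} : ℕ
    closesAt : Fin (suc types) → Fin (suc types) → Bool
    profile : Fin (suc types) → List Ends
    next    : Fin (suc types) → Fin (suc types) → Fin types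
    profile-side : profile zero ≡ replicate (suc classes) (lonely , lonely)
    profile-next : ∀ l r → Match (profile l) (profile r)
      (flag (weight leafWeight (isSide l ∧ isSide r)) (profile (suc (next l r))))
    closes       : ∀ l r → T (closesAt l r) →
      ∃[ τ ] Closes (suc classes) leafWeight (profile l) (profile r) (isSide l) (isSide r) τ

-- The two schemes, with six and with three sets.

-- D, L, P, O, C: dominated, lonely, paired, promised, chosen.
pattern DD = dominated , dominated
pattern DP = dominated , paired
pattern DL = dominated , lonely
pattern PD = paired , dominated
pattern LD = lonely , dominated
pattern LL = lonely , lonely
pattern OP = promised , paired
pattern PO = paired , promised
pattern OO = promised , promised
pattern CD = chosen , dominated
pattern DC = dominated , chosen

-- Candidates for the final profile: the last apex enters the leading sets, and each end of the
-- closing edge is chosen in as many sets as its weight pays for. Only the middle part is searched.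
closings : ℕ → Bool → Bool → List (List Ends) → List (List Ends)
closings a l r = map λ τ →
  replicate (weight a (l ∧ r)) DD ++ τ ++ replicate (weight a l) CD ++ replicate (weight a r) DC

-- Found by computing the closure of the profiles under gluing, keeping the weakest.
profile₆ : Fin 8 → List Ends
profile₆ 0F = LL ∷ LL ∷ LL ∷ LL ∷ LL ∷ LL ∷ []
profile₆ 1F = DD ∷ DD ∷ OP ∷ PO ∷ CD ∷ DC ∷ []
profile₆ 2F = DD ∷ OO ∷ LD ∷ LD ∷ CD ∷ DC ∷ []
profile₆ 3F = DD ∷ OO ∷ DL ∷ DL ∷ CD ∷ DC ∷ []
profile₆ 4F = DD ∷ OP ∷ LL ∷ LD ∷ CD ∷ DC ∷ []
profile₆ 5F = DD ∷ PO ∷ LL ∷ DL ∷ CD ∷ DC ∷ []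
profile₆ 6F = DD ∷ PO ∷ DP ∷ DL ∷ CD ∷ DC ∷ []
profile₆ 7F = DD ∷ OP ∷ PD ∷ LD ∷ CD ∷ DC ∷ []

next₆ : Fin 8 → Fin 8 → Fin 7
next₆ 0F 0F = 0F
next₆ 0F 1F = 1F
next₆ 0F 2F = 6F
next₆ 0F 3F = 3F
next₆ 0F 4F = 6F
next₆ 0F 5F = 3F
next₆ 0F 6F = 3F
next₆ 0F 7F = 6F
next₆ 1F 0F = 2F
next₆ 2F 0F = 4F
next₆ 3F 0F = 5F
next₆ 4F 0F = 4F
next₆ 5F 0F = 5F
next₆ 6F 0F = 5F
next₆ 7F 0F = 4F
next₆ (suc _) (suc _) = 0F

-- Lengths 0, 2 and 3 complete the six sets when both, one or neither of the chords at the last apex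
-- are sides.
rests₆ : List (List Ends)
rests₆ = [] ∷ (LL ∷ PD ∷ []) ∷ (LL ∷ DP ∷ []) ∷ (LL ∷ DP ∷ PD ∷ []) ∷ []

scheme₆ : Scheme
scheme₆ = record
  { classes      = 5
  ; leafWeight   = 2
  ; closesAt     = λ _ _ → true
  ; profile      = profile₆
  ; next         = next₆
  ; profile-side = refl
  ; profile-next = toWitness {a? = Fin.all? λ l → Fin.all? λ r → match? (profile₆ l) (profile₆ r) _} _
  ; closes       = λ l r _ → satisfied (toWitness {a? = Fin.all? λ l → Fin.all? λ r →
      any? (closes? 6 2 (profile₆ l) (profile₆ r) (isSide l) (isSide r)) (closings 2 (isSide l) (isSide r) rests₆)} _ l r)
  }

profile₃ : Fin 3 → List Ends
profile₃ 0F = LL ∷ LL ∷ LL ∷ []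
profile₃ 1F = OP ∷ CD ∷ DC ∷ []
profile₃ 2F = DD ∷ CD ∷ DC ∷ []

next₃ : Fin 3 → Fin 3 → Fin 2
next₃ 0F 0F = 0F
next₃ _  _  = 1F

-- The excluded cases are the polygons with fewer than five corners.
closesAt₃ : Fin 3 → Fin 3 → Bool
closesAt₃ 0F      0F      = false
closesAt₃ 0F      1F      = false
closesAt₃ 0F      2F      = true
closesAt₃ (suc _) (suc _) = true
closesAt₃ 1F      0F      = false
closesAt₃ 2F      0F      = true

rests₃ : List (List Ends)
rests₃ = [] ∷ (LL ∷ []) ∷ (DP ∷ []) ∷ (PD ∷ []) ∷ []

scheme₃ : Scheme
scheme₃ = record
  { classes      = 2
  ; leafWeight   = 0
  ; closesAt     = closesAt₃
  ; profile      = profile₃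
  ; next         = next₃
  ; profile-side = refl
  ; profile-next = toWitness {a? = Fin.all? λ l → Fin.all? λ r → match? (profile₃ l) (profile₃ r) _} _
  ; closes       = λ l r p → satisfied (toWitness {a? = Fin.all? λ l → Fin.all? λ r → Bool.T? (closesAt₃ l r) →-dec
      any? (closes? 3 0 (profile₃ l) (profile₃ r) (isSide l) (isSide r)) (closings 0 (isSide l) (isSide r) rests₃)} _ l r p)
  }

-- Prefix sums, and soundness of gluing and closing.

total : (ℕ → ℕ) → ℕ → ℕ
total w zero    = 0
total w (suc x) = total w x + w x

module Chords (A : ℕ → ℕ → Set) (A-sym : ∀ {x y} → A x y → A y x) (A-irrefl : ∀ {x} → ¬ A x x)
  (confined : ∀ {i k j y} → i < k → k < j → A i j → A k y → i ≤ y × y ≤ j) where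

  -- Membership of `x` in the set, expressed only by its effect on the undominated vertices `U`.
  Kills : Pred ℕ 0ℓ → ℕ → Set
  Kills U x = ¬ U x × (∀ y → A x y → ¬ U y)

  Given : Pred ℕ 0ℓ → State → ℕ → Set
  Given U s x = (T (isChosen s) → Kills U x) × (T (isPromised s) → ¬ U x)

  Outcome : Pred ℕ 0ℓ → State → ℕ → Pred ℕ 0ℓ → Set
  Outcome U s x R = (T (isDominated s) → ¬ U x) × (U x → Few (cap s) (λ y → U y × A x y × R y))

  Strictly : ℕ → ℕ → Pred ℕ 0ℓ
  Strictly i j x = i < x × x < j

  record Local (U : Pred ℕ 0ℓ) (i j : ℕ) (s t : State) : Set where
    constructor local
    field
      inner : ∀ x → Strictly i j x → U x → Few 1 (λ y → U y × A x y)
      left  : Outcome U s i (Strictly i j)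
      right : Outcome U t j (Strictly i j)
  open Local

  -- U is the set of undominated vertices.  Quantifying over every U that S and the
  -- assumptions at the ends allow lets one S serve in all larger pieces.
  Sol : ℕ → ℕ → List ℕ → Ends → Set₁
  Sol i j S (s , t) = ∀ U → (∀ x → x ∈ S → Kills U x) → Given U s i → Given U t j → Local U i j s t

  -- A dominated end carries no assumption, so its part can be run first and then keep the promise
  -- made to the other part.
  given-dominated : ∀ {U s x} → T (isDominated s) → Given U s x
  given-dominated {s = dominated} _ = (λ ()) , (λ ())

  permits-given : ∀ {U x} s {killed safe} → T (permits s killed safe) →
    (T killed → Kills U x) → (T safe → ¬ U x) → Given U s x
  permits-given s p kill safe with q , r ← ∧-split p =
    kill ∘ not-∨ q , safe ∘ not-∨ r

  sol-side : ∀ i → Sol i (suc i) [] (lonely , lonely)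
  sol-side i U _ _ _ = local (λ x (i<x , x<1+i) → ⊥-elim (<⇒≱ i<x (s≤s⁻¹ x<1+i)))
    ((λ ()) , λ _ y (_ , _ , i<y , y<1+i) → <⇒≱ i<y (s≤s⁻¹ y<1+i))
    ((λ ()) , λ _ y (_ , _ , i<y , y<1+i) → <⇒≱ i<y (s≤s⁻¹ y<1+i))

  outcome : ∀ {U x k R R′ s s′ safe safeₖ} → T (endOK s s′ safe safeₖ) →
    (T safe → ¬ U x) → (T safeₖ → ¬ U k) → Outcome U s′ x R′ →
    (∀ y → A x y → R y → R′ y ⊎ y ≡ k) → Outcome U s x R
  outcome {U} {x} {k} {s = s} {s′} {safe} {safeₖ} e known knownₖ (_ , few) cover with ∨-split {safe} e
  ... | inj₁ p = (λ _ → known p) , (λ Ux → ⊥-elim (known p Ux))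
  ... | inj₂ p with q , r ← ∧-split {not (isDominated s)} p =
    (λ dom → ⊥-elim (undominated s q dom)) ,
    λ Ux → few-≤ (≤ᵇ⇒≤ _ _ r)
      (few-⊆ (cap s′ + tally safeₖ)
        (λ { {y} (Uy , Axy , Ry) → [ (λ R′y → inj₁ (Uy , Axy , R′y)) , (λ y≡k → inj₂ (Uy , y≡k)) ]′ (cover y Axy Ry) })
        (few-∪ (cap s′) (tally safeₖ) (few Ux) (few-tally {safeₖ} knownₖ)))
    where
    undominated : ∀ s → T (not (isDominated s)) → ¬ T (isDominated s)
    undominated dominated ()

  -- Facts are derived in this order: the e's from the apex and the assumptions at the ends, then
  -- the two parts, then the d's. Neighbours of `k` stay within the chord `ij`, so four bounds cover
  -- them all.
  sol-glue : ∀ {i k j S₁ S₂} e₁ e₂ b e → i < k → k < j → A i j → A i k → A k j →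
    T (glueable e₁ e₂ b e) → Sol i k S₁ e₁ → Sol k j S₂ e₂ → Sol i j (S₁ ++ insert b k ++ S₂) e
  sol-glue {i} {k} {j} {S₁} {S₂} (s₁ , t₁) (s₂ , t₂) b (s , t) i<k k<j Aij Aik Akj g sol₁ sol₂ U kills givenᵢ givenⱼ
    with p₁ , g ← ∧-split g
    with p₂ , g ← ∧-split g
    with p₃ , g ← ∧-split g
    with p₄ , g ← ∧-split g
    with p₅ , g ← ∧-split g
    with p₆ , p₇ ← ∧-split g = local inner′
      (outcome {k = k} {s = s} p₆ dᵢ dₖ (left L₁) coverᵢ)
      (outcome {k = k} {s = t} p₇ dⱼ dₖ (right L₂) coverⱼ)
    where
    killₖ : T b → Kills U k
    killₖ = go b kills
      where
      -- `b` is generalised together with `kills`, so that matching on it exposes `k` in the list.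
      go : ∀ b → (∀ x → x ∈ (S₁ ++ insert b k ++ S₂) → Kills U x) → T b → Kills U k
      go true kills _ = kills k (∈-++⁺ʳ S₁ (here refl))
    eᵢ : T (isChosen s ∨ isPromised s ∨ b ∨ isChosen t) → ¬ U i
    eᵢ = ∨-elim {isChosen s} (proj₁ ∘ proj₁ givenᵢ) (∨-elim {isPromised s} (proj₂ givenᵢ)
      (∨-elim {b} (λ p → proj₂ (killₖ p) i (A-sym Aik)) (λ p → proj₂ (proj₁ givenⱼ p) i (A-sym Aij))))
    eⱼ : T (isChosen t ∨ isPromised t ∨ b ∨ isChosen s) → ¬ U j
    eⱼ = ∨-elim {isChosen t} (proj₁ ∘ proj₁ givenⱼ) (∨-elim {isPromised t} (proj₂ givenⱼ)
      (∨-elim {b} (λ p → proj₂ (killₖ p) j Akj) (λ p → proj₂ (proj₁ givenᵢ p) j Aij)))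
    eₖ : T (b ∨ isChosen s ∨ isChosen t) → ¬ U k
    eₖ = ∨-elim {b} (proj₁ ∘ killₖ) (∨-elim {isChosen s} (λ p → proj₂ (proj₁ givenᵢ p) k Aik)
      (λ p → proj₂ (proj₁ givenⱼ p) k (A-sym Akj)))
    run₁ : Given U t₁ k → Local U i k s₁ t₁
    run₁ = sol₁ U (λ x → kills x ∘ ∈-++⁺ˡ) (permits-given s₁ p₁ (proj₁ givenᵢ) eᵢ)
    run₂ : Given U s₂ k → Local U k j s₂ t₂
    run₂ given = sol₂ U (λ x → kills x ∘ ∈-++⁺ʳ S₁ ∘ ∈-++⁺ʳ (insert b k)) given
      (permits-given t₂ p₂ (proj₁ givenⱼ) eⱼ)
    L₁ : Local U i k s₁ t₁
    L₁ = run₁ (permits-given t₁ p₃ killₖ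
      (∨-elim {isDominated s₂} (λ d → proj₁ (left (run₂ (given-dominated d))) d) eₖ))
    L₂ : Local U k j s₂ t₂
    L₂ = run₂ (permits-given s₂ p₄ killₖ
      (∨-elim {isDominated t₁} (λ d → proj₁ (right (run₁ (given-dominated d))) d) eₖ))
    dᵢ? = isDominated s₁ ∨ isChosen s ∨ isPromised s ∨ b ∨ isChosen t
    dⱼ? = isDominated t₂ ∨ isChosen t ∨ isPromised t ∨ b ∨ isChosen s
    dᵢ : T dᵢ? → ¬ U i
    dᵢ = ∨-elim {isDominated s₁} (proj₁ (left L₁)) eᵢ
    dⱼ : T dⱼ? → ¬ U j
    dⱼ = ∨-elim {isDominated t₂} (proj₁ (right L₂)) eⱼ
    dₖ : T (isDominated t₁ ∨ isDominated s₂ ∨ b ∨ isChosen s ∨ isChosen t) → ¬ U k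
    dₖ = ∨-elim {isDominated t₁} (proj₁ (right L₁)) (∨-elim {isDominated s₂} (proj₁ (left L₂)) eₖ)
    coverᵢ : ∀ y → A i y → Strictly i j y → Strictly i k y ⊎ y ≡ k
    coverᵢ y Aiy (i<y , y<j) with <-cmp y k
    ... | tri< y<k _ _ = inj₁ (i<y , y<k)
    ... | tri≈ _ y≡k _ = inj₂ y≡k
    -- Here `y` is strictly inside the chord `kj`, while its neighbour `i` is outside.
    ... | tri> _ _ k<y = ⊥-elim (<⇒≱ i<k (proj₁ (confined k<y y<j Akj (A-sym Aiy))))
    coverⱼ : ∀ y → A j y → Strictly i j y → Strictly k j y ⊎ y ≡ k
    coverⱼ y Ajy (i<y , y<j) with <-cmp y k
    ... | tri< y<k _ _ = ⊥-elim (<⇒≱ k<j (proj₂ (confined i<y y<k Aik (A-sym Ajy))))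
    ... | tri≈ _ y≡k _ = inj₂ y≡k
    ... | tri> _ _ k<y = inj₁ (k<y , y<j)
    coverₖ : ∀ {y} → U y × A k y →
      ((U y × A k y × Strictly i k y) ⊎ (U y × A k y × Strictly k j y)) ⊎ ((U y × y ≡ i) ⊎ (U y × y ≡ j))
    coverₖ {y} (Uy , Aky) with confined i<k k<j Aij Aky
    ... | i≤y , y≤j with m≤n⇒m<n∨m≡n i≤y | m≤n⇒m<n∨m≡n y≤j
    ... | inj₂ refl | _ = inj₂ (inj₁ (Uy , refl))
    ... | inj₁ _ | inj₂ refl = inj₂ (inj₂ (Uy , refl))
    ... | inj₁ i<y | inj₁ y<j with <-cmp y k
    ... | tri< y<k _ _ = inj₁ (inj₁ (Uy , Aky , i<y , y<k))
    ... | tri≈ _ refl _ = ⊥-elim (A-irrefl Aky)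
    ... | tri> _ _ k<y = inj₁ (inj₂ (Uy , Aky , k<y , y<j))
    innerₖ : U k → Few 1 (λ y → U y × A k y)
    innerₖ Uk with ∨-split {isDominated t₁ ∨ isDominated s₂ ∨ b ∨ isChosen s ∨ isChosen t} p₅
    ... | inj₁ d = ⊥-elim (dₖ d Uk)
    ... | inj₂ c = few-≤ (≤ᵇ⇒≤ _ _ c) (few-⊆ (cap t₁ + cap s₂ + (tally dᵢ? + tally dⱼ?)) coverₖ
      (few-∪ (cap t₁ + cap s₂) _ (few-∪ (cap t₁) _ (proj₂ (right L₁) Uk) (proj₂ (left L₂) Uk))
        (few-∪ (tally dᵢ?) (tally dⱼ?) (few-tally {dᵢ?} dᵢ) (few-tally {dⱼ?} dⱼ))))
    inner′ : ∀ x → Strictly i j x → U x → Few 1 (λ y → U y × A x y)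
    inner′ x (i<x , x<j) with <-cmp x k
    ... | tri< x<k _ _ = inner L₁ x (i<x , x<k)
    ... | tri≈ _ refl _ = innerₖ
    ... | tri> _ _ k<x = inner L₂ x (k<x , x<j)

  sol-close : ∀ {i j S} e → i < j → A i j → (∀ {x y} → i ≤ x → x ≤ j → A x y → i ≤ y × y ≤ j) →
    T (closable e) → Sol i j S e →
    ∀ U → (∀ x → x ∈ (closing i j e ++ S) → Kills U x) → ∀ x → i ≤ x → x ≤ j → U x → Few 1 (λ y → U y × A x y)
  sol-close {i} {j} {S} (s , t) i<j Aij closed c sol U kills
    with p₁ , c ← ∧-split c
    with p₂ , c ← ∧-split c
    with p₃ , p₄ ← ∧-split c = everywhere
    where
    killᵢ : T (isChosen s) → Kills U i
    killᵢ = go (isChosen s) kills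
      where
      go : ∀ b → (∀ x → x ∈ ((insert b i ++ insert (isChosen t) j) ++ S) → Kills U x) → T b → Kills U i
      go true kills _ = kills i (here refl)
    killⱼ : T (isChosen t) → Kills U j
    killⱼ = go (isChosen t) kills
      where
      go : ∀ b → (∀ x → x ∈ ((insert (isChosen s) i ++ insert b j) ++ S) → Kills U x) → T b → Kills U j
      go true kills _ = kills j (∈-++⁺ˡ (∈-++⁺ʳ (insert (isChosen s) i) (here refl)))
    e? = isChosen s ∨ isChosen t
    eᵢ : T e? → ¬ U i
    eᵢ = ∨-elim {isChosen s} (proj₁ ∘ killᵢ) (λ p → proj₂ (killⱼ p) i (A-sym Aij))
    eⱼ : T e? → ¬ U j
    eⱼ = ∨-elim {isChosen s} (λ p → proj₂ (killᵢ p) j Aij) (proj₁ ∘ killⱼ)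
    L : Local U i j s t
    L = sol U (λ x → kills x ∘ ∈-++⁺ʳ (closing i j (s , t)))
      (permits-given s p₁ killᵢ eᵢ) (permits-given t p₂ killⱼ eⱼ)
    dᵢ? = isDominated s ∨ e?
    dⱼ? = isDominated t ∨ e?
    dᵢ : T dᵢ? → ¬ U i
    dᵢ = ∨-elim {isDominated s} (proj₁ (left L)) eᵢ
    dⱼ : T dⱼ? → ¬ U j
    dⱼ = ∨-elim {isDominated t} (proj₁ (right L)) eⱼ
    endpoint : ∀ {x z} s → Outcome U s x (Strictly i j) → (∀ {y} → A x y → Strictly i j y ⊎ y ≡ z) →
      (d d′ : Bool) → (T d → ¬ U x) → (T d′ → ¬ U z) → T (d ∨ (cap s + tally d′ ≤ᵇ 1)) →
      U x → Few 1 (λ y → U y × A x y)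
    endpoint s (_ , few) cover d d′ known known′ c Ux with ∨-split {d} c
    ... | inj₁ p = ⊥-elim (known p Ux)
    ... | inj₂ p = few-≤ (≤ᵇ⇒≤ _ _ p) (few-⊆ (cap s + tally d′)
      (λ { (Uy , Axy) → [ (λ r → inj₁ (Uy , Axy , r)) , (λ y≡z → inj₂ (Uy , y≡z)) ]′ (cover Axy) })
      (few-∪ (cap s) (tally d′) (few Ux) (few-tally {d′} known′)))
    coverᵢ : ∀ {y} → A i y → Strictly i j y ⊎ y ≡ j
    coverᵢ Aiy with i≤y , y≤j ← closed ≤-refl (<⇒≤ i<j) Aiy with m≤n⇒m<n∨m≡n i≤y | m≤n⇒m<n∨m≡n y≤j
    ... | inj₂ refl | _ = ⊥-elim (A-irrefl Aiy)
    ... | inj₁ i<y | inj₁ y<j = inj₁ (i<y , y<j)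
    ... | inj₁ _ | inj₂ y≡j = inj₂ y≡j
    coverⱼ : ∀ {y} → A j y → Strictly i j y ⊎ y ≡ i
    coverⱼ Ajy with i≤y , y≤j ← closed (<⇒≤ i<j) ≤-refl Ajy with m≤n⇒m<n∨m≡n i≤y | m≤n⇒m<n∨m≡n y≤j
    ... | _ | inj₂ refl = ⊥-elim (A-irrefl Ajy)
    ... | inj₁ i<y | inj₁ y<j = inj₁ (i<y , y<j)
    ... | inj₂ refl | _ = inj₂ refl
    everywhere : ∀ x → i ≤ x → x ≤ j → U x → Few 1 (λ y → U y × A x y)
    everywhere x i≤x x≤j with m≤n⇒m<n∨m≡n i≤x | m≤n⇒m<n∨m≡n x≤j
    ... | inj₁ i<x | inj₁ x<j = inner L x (i<x , x<j)
    ... | inj₂ refl | _ = endpoint s (left L) coverᵢ dᵢ? dⱼ? dᵢ dⱼ p₃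
    ... | _ | inj₂ refl = endpoint t (right L) coverⱼ dⱼ? dᵢ? dⱼ dᵢ p₄

  -- Trees of chords, and the total size of the sets they carry.

  data Tree : ℕ → ℕ → Set where
    side  : ∀ {i} → A i (suc i) → Tree i (suc i)
    split : ∀ {i k j} → A i j → Tree i k → Tree k j → Tree i j

  edge : ∀ {i j} → Tree i j → A i j
  edge (side e)      = e
  edge (split e _ _) = e

  ascending : ∀ {i j} → Tree i j → i < j
  ascending (side _)      = n<1+n _
  ascending (split _ l r) = <-trans (ascending l) (ascending r)

  isSideTree : ∀ {i j} → Tree i j → Bool
  isSideTree (side _)      = true
  isSideTree (split _ _ _) = false

  infixr 5 _∷_
  -- The index `c` is the total size of the sets; averaging needs nothing else about their sizes.
  data Realizes (i j : ℕ) : List Ends → ℕ → Set₁ where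
    []  : Realizes i j [] 0
    _∷_ : ∀ {S e τ c} → Sol i j S e → Realizes i j τ c → Realizes i j (e ∷ τ) (length S + c)

  pick : ∀ {i j e τ τ′ c} → (e , τ′) ∈ picks τ → Realizes i j τ c →
    ∃[ S ] ∃[ c′ ] (Sol i j S e × Realizes i j τ′ c′ × c ≡ length S + c′)
  pick {τ = x ∷ xs} p (_∷_ {S} {c = c} sol sols) with ∈-++⁻ (map _ (picks xs)) p
  ... | inj₂ (here refl) = S , c , sol , sols , refl
  ... | inj₁ q with ∈-map⁻ _ q
  ... | _ , q′ , refl with S′ , c′ , sol′ , sols′ , refl ← pick q′ sols =
    S′ , length S + c′ , sol′ , sol ∷ sols′ ,
    solve 3 (λ a b c → a :+ (b :+ c) := b :+ (a :+ c)) refl (length S) (length S′) c′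
    where open +-*-Solver

  length-insert : ∀ b k → length (insert b k) ≡ bit b
  length-insert true  k = refl
  length-insert false k = refl

  glue : ∀ {i k j} τ₁ τ₂ gs {c₁ c₂} → i < k → k < j → A i j → A i k → A k j → Match τ₁ τ₂ gs →
    Realizes i k τ₁ c₁ → Realizes k j τ₂ c₂ →
    ∃[ c ] (Realizes i j (map proj₂ gs) c × c ≤ flags gs + (c₁ + c₂))
  -- Sets left over are dropped; the inequality absorbs their size.
  glue τ₁ τ₂ [] _ _ _ _ _ _ _ _ = 0 , [] , z≤n
  glue {k = k} τ₁ τ₂ ((b , e) ∷ gs) i<k k<j Aij Aik Akj m R₁ R₂
    with (e₁ , τ₁′) , ∈₁ , m ← find m
    with (e₂ , τ₂′) , ∈₂ , g , m ← find m
    with S₁ , c₁ , sol₁ , R₁ , refl ← pick ∈₁ R₁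
    with S₂ , c₂ , sol₂ , R₂ , refl ← pick ∈₂ R₂
    with c , R , c≤ ← glue τ₁′ τ₂′ gs i<k k<j Aij Aik Akj m R₁ R₂ =
    _ , sol-glue e₁ e₂ b e i<k k<j Aij Aik Akj g sol₁ sol₂ ∷ R , (begin
      length (S₁ ++ insert b k ++ S₂) + c
        ≡⟨ cong (_+ c) (trans (length-++ S₁) (cong (length S₁ +_) (trans (length-++ (insert b k))
             (cong (_+ length S₂) (length-insert b k))))) ⟩
      length S₁ + (bit b + length S₂) + c
        ≤⟨ +-monoʳ-≤ (length S₁ + (bit b + length S₂)) c≤ ⟩
      length S₁ + (bit b + length S₂) + (flags gs + (c₁ + c₂))
        ≡⟨ solve 6 (λ s₁ b s₂ f c₁ c₂ → s₁ :+ (b :+ s₂) :+ (f :+ (c₁ :+ c₂)) :=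
             b :+ f :+ ((s₁ :+ c₁) :+ (s₂ :+ c₂))) refl (length S₁) (bit b) (length S₂) (flags gs) c₁ c₂ ⟩
      bit b + flags gs + ((length S₁ + c₁) + (length S₂ + c₂)) ∎)
    where
    open ≤-Reasoning
    open +-*-Solver

  Isolates : ℕ → ℕ → List ℕ → Set₁
  Isolates i j S = ∀ U → (∀ x → x ∈ S → Kills U x) → ∀ x → i ≤ x → x ≤ j → U x → Few 1 (λ y → U y × A x y)

  length-closing : ∀ i j e → length (closing i j e) ≡ chosenEnds e
  length-closing i j (s , t) = trans (length-++ (insert (isChosen s) i))
    (cong₂ _+_ (length-insert (isChosen s) i) (length-insert (isChosen t) j))

  -- The minimum is at most the average. Closing adds `chosenEnds` to the size of each set, and a
  -- nonempty list ensures that a minimum exists.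
  cheapest : ∀ {i j e τ c} → i < j → A i j → (∀ {x y} → i ≤ x → x ≤ j → A x y → i ≤ y × y ≤ j) →
    All (T ∘ closable) (e ∷ τ) → Realizes i j (e ∷ τ) c →
    ∃[ S ] (Isolates i j S × length (e ∷ τ) * length S ≤ c + sum (map chosenEnds (e ∷ τ)))
  cheapest {i} {j} {e} i<j Aij closed (p ∷ ps) (_∷_ {S} {c = c} sol sols) = go ps sols
    where
    open ≤-Reasoning
    open +-*-Solver
    S₀ = closing i j e ++ S
    iso₀ : Isolates i j S₀
    iso₀ = sol-close e i<j Aij closed p sol
    length-S₀ : length S₀ ≡ chosenEnds e + length S
    length-S₀ = trans (length-++ (closing i j e)) (cong (_+ length S) (length-closing i j e))
    combine : ∀ m {x y B C} → x ≤ chosenEnds e + length S → x ≤ y → m * y ≤ B + C →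
      suc m * x ≤ length S + B + (chosenEnds e + C)
    combine m {x} {y} {B} {C} p q r = begin
      x + m * x                                  ≤⟨ +-mono-≤ p (≤-trans (*-monoʳ-≤ m q) r) ⟩
      chosenEnds e + length S + (B + C)          ≡⟨ solve 4 (λ a b c d → a :+ b :+ (c :+ d) := b :+ c :+ (a :+ d))
                                                      refl (chosenEnds e) (length S) B C ⟩
      length S + B + (chosenEnds e + C)          ∎
    go : ∀ {τ c} → All (T ∘ closable) τ → Realizes i j τ c →
      ∃[ S′ ] (Isolates i j S′ × suc (length τ) * length S′ ≤ length S + c + (chosenEnds e + sum (map chosenEnds τ)))
    go [] [] = S₀ , iso₀ , ≤-reflexive (trans (cong (_+ 0) length-S₀)
      (solve 2 (λ a b → a :+ b :+ con 0 := b :+ con 0 :+ (a :+ con 0)) refl (chosenEnds e) (length S)))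
    go {e′ ∷ τ} {c} ps@(_ ∷ _) sols@(_ ∷ _) with cheapest i<j Aij closed ps sols
    ... | S′ , iso′ , b with ≤-total (length S₀) (length S′)
    ... | inj₁ S₀≤S′ = S₀ , iso₀ , combine (length (e′ ∷ τ)) (≤-reflexive length-S₀) S₀≤S′ b
    ... | inj₂ S′≤S₀ = S′ , iso′ , combine (length (e′ ∷ τ)) (≤-trans S′≤S₀ (≤-reflexive length-S₀)) ≤-refl b

  -- Existence of the tree of chords.

  module Triangulation (A? : ∀ x y → Dec (A x y)) (M : ℕ)
    (A-bounded : ∀ {x y} → A x y → y ≤ M) (A-side : ∀ {x} → suc x ≤ M → A x (suc x))
    (crossed : ∀ {a b} → a < b → b ≤ M → ¬ A a b →
      ∃[ c ] ∃[ d ] (A c d × (a < c × c < b) × (d < a ⊎ b < d))) where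

    -- The search runs downwards from `suc i + d` and stops at the latest at the side from `i` to
    -- `suc i`.
    lastNeighbour : ∀ i d → suc i ≤ M →
      ∃[ k ] (i < k × k ≤ suc i + d × A i k × (∀ y → k < y → y ≤ suc i + d → ¬ A i y))
    lastNeighbour i zero 1+i<N = suc i , n<1+n i , m≤m+n (suc i) 0 , A-side 1+i<N ,
      λ y k<y y≤ → ⊥-elim (<⇒≱ k<y (subst (y ≤_) (+-identityʳ (suc i)) y≤))
    lastNeighbour i (suc d) 1+i<N with A? i (suc i + suc d)
    ... | yes a = suc i + suc d , s≤s (m≤m+n i (suc d)) , ≤-refl , a , λ y k<y y≤ → ⊥-elim (<⇒≱ k<y y≤)
    ... | no ¬a with lastNeighbour i d 1+i<N
    ... | k , i<k , k≤ , a , last = k , i<k , ≤-trans k≤ (+-monoʳ-≤ (suc i) (n≤1+n d)) , a , last′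
      where
      last′ : ∀ y → k < y → y ≤ suc i + suc d → ¬ A i y
      last′ y k<y y≤ with m≤n⇒m<n∨m≡n y≤
      ... | inj₂ refl = ¬a
      ... | inj₁ y< = last y k<y (≤-pred (subst (y <_) (+-suc (suc i) d) y<))

    -- Take `k` as the last neighbour of `i` before `j`. If `kj` were missing, some edge would cross
    -- it, with one end strictly between `k` and `j`. Its other end cannot lie outside `ij` or
    -- strictly between `i` and `k` without a crossing, and `i` itself would contradict the choice
    -- of `k`.
    apex : ∀ {i j} → suc i < j → A i j → ∃[ k ] (i < k × k < j × A i k × A k j)
    apex {i} {j} 1+i<j ij with m≤n⇒∃[o]m+o≡n 1+i<j
    ... | d , refl with lastNeighbour i d (≤-trans (<⇒≤ 1+i<j) (A-bounded ij))
    ... | k , i<k , k≤ , ik , last with A? k j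
    ... | yes kj = k , i<k , s≤s k≤ , ik , kj
    ... | no ¬kj with crossed (s≤s k≤) (A-bounded ij) ¬kj
    ... | c , e , ce , (k<c , c<j) , out with confined (<-trans i<k k<c) c<j ij ce
    ... | i≤e , e≤j with out
    ... | inj₂ j<e = ⊥-elim (<⇒≱ j<e e≤j)
    ... | inj₁ e<k with m≤n⇒m<n∨m≡n i≤e
    ... | inj₁ i<e = ⊥-elim (<⇒≱ k<c (proj₂ (confined i<e e<k ik (A-sym ce))))
    ... | inj₂ refl = ⊥-elim (last _ k<c (≤-pred c<j) (A-sym ce))

    -- `d` bounds `j - i`, which drops for both parts.
    triangulate : ∀ d {i j} → i < j → j ≤ i + d → A i j → Tree i j
    triangulate zero    i<j j≤i+d _ = ⊥-elim (<⇒≱ i<j (≤-trans j≤i+d (≤-reflexive (+-identityʳ _))))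
    triangulate (suc d) {i} {j} i<j j≤i+d ij with m≤n⇒m<n∨m≡n i<j
    ... | inj₂ refl = side ij
    ... | inj₁ 1+i<j with apex 1+i<j ij
    ... | k , i<k , k<j , ik , kj = split ij
      (triangulate d i<k (≤-pred (<-≤-trans k<j (≤-trans j≤i+d (≤-reflexive (+-suc i d))))) ik)
      (triangulate d k<j (≤-trans j≤i+d (≤-trans (≤-reflexive (+-suc i d)) (+-monoˡ-≤ d i<k))) kj)

  -- Induction along the tree, with the weight count.

  module Induction (leaf? : ℕ → Bool)
    (leaf-apex : ∀ {i k j} → A i j → (l : Tree i k) (r : Tree k j) → leaf? k ≡ isSideTree l ∧ isSideTree r)
    (σ : Scheme) where
    open Scheme σ

    w : ℕ → ℕ
    w x = weight leafWeight (leaf? x)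

    type : ∀ {i j} → Tree i j → Fin (suc types)
    type (side _)      = zero
    type (split _ l r) = suc (next (type l) (type r))

    isSide-type : ∀ {i j} (t : Tree i j) → isSide (type t) ≡ isSideTree t
    isSide-type (side _)      = refl
    isSide-type (split _ _ _) = refl

    apexWeight : ∀ {i k j} → Tree i k → Tree k j → ℕ
    apexWeight l r = weight leafWeight (isSide (type l) ∧ isSide (type r))

    sides : ∀ i m → Realizes i (suc i) (replicate m (lonely , lonely)) 0
    sides i zero    = []
    sides i (suc m) = sol-side i ∷ sides i m

    -- The budget is the weight of the corners strictly between `i` and `j`, as a difference of
    -- prefix sums written without subtraction.
    Affordable : ℕ → ℕ → List Ends → Set₁
    Affordable i j τ = ∃[ c ] (Realizes i j τ c × c + total w (suc i) ≤ total w j)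

    -- Each part is paid for by the corners strictly inside its chord, and the apex pays for its own
    -- insertions; the prefix sums telescope.
    affordable-glue : ∀ {i k j} (l : Tree i k) (r : Tree k j) → A i j → ∀ τ →
      Affordable i k (profile (type l)) → Affordable k j (profile (type r)) →
      Match (profile (type l)) (profile (type r)) (flag (apexWeight l r) τ) →
      Affordable i j τ
    affordable-glue {i} {k} {j} l r Aij τ (c₁ , R₁ , p₁) (c₂ , R₂ , p₂) m
      with c , R , c≤ ← glue _ _ (flag (apexWeight l r) τ) (ascending l) (ascending r) Aij (edge l) (edge r) m R₁ R₂ =
      c , subst (λ τ → Realizes i j τ c) (map-proj₂-flag (apexWeight l r) τ) R , (begin
        c + total w (suc i)                            ≤⟨ +-monoˡ-≤ _ c≤ ⟩
        flags (flag wₖ τ) + (c₁ + c₂) + total w (suc i) ≤⟨ +-monoˡ-≤ _ (+-monoˡ-≤ _ (flags-flag wₖ τ)) ⟩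
        wₖ + (c₁ + c₂) + total w (suc i)               ≡⟨ solve 4 (λ a b c d → a :+ (b :+ c) :+ d := c :+ ((b :+ d) :+ a))
                                                            refl wₖ c₁ c₂ (total w (suc i)) ⟩
        c₂ + ((c₁ + total w (suc i)) + wₖ)             ≤⟨ +-monoʳ-≤ c₂ (+-monoˡ-≤ wₖ p₁) ⟩
        c₂ + (total w k + wₖ)                          ≡⟨ cong (λ v → c₂ + (total w k + v)) wₖ≡ ⟩
        c₂ + total w (suc k)                           ≤⟨ p₂ ⟩
        total w j                                      ∎)
      where
      open ≤-Reasoning
      open +-*-Solver
      wₖ = apexWeight l r
      wₖ≡ : wₖ ≡ w k
      wₖ≡ = cong (weight leafWeight) (trans (cong₂ _∧_ (isSide-type l) (isSide-type r)) (≡-sym (leaf-apex Aij l r)))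

    affordable : ∀ {i j} (t : Tree i j) → Affordable i j (profile (type t))
    affordable (side {i} _) = subst (Affordable i (suc i)) (≡-sym profile-side) (0 , sides i _ , ≤-refl)
    affordable (split e l r) =
      affordable-glue l r e _ (affordable l) (affordable r) (profile-next (type l) (type r))

    -- The last triangle is glued directly to a closable profile, and the remaining corners 0 and
    -- `M` pay for the ends chosen there.
    isolate : ∀ {k M} (l : Tree 0 k) (r : Tree k M) → A 0 M → (∀ {x y} → A x y → y ≤ M) →
      leaf? 0 ≡ isSideTree l → leaf? M ≡ isSideTree r → T (closesAt (type l) (type r)) →
      ∃[ S ] (Isolates 0 M S × suc classes * length S ≤ total w (suc M))
    isolate {k} {M} l r e bounded leaf₀ leaf-M adm
      with closes (type l) (type r) adm
    ... | e₀ ∷ τ , refl , ps , ends≤ , m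
      with c , R , c≤ ← affordable-glue l r e (e₀ ∷ τ) (affordable l) (affordable r) m
      with S , iso , S≤ ← cheapest (<-trans (ascending l) (ascending r)) e (λ _ _ a → z≤n , bounded a) ps R =
      S , iso , (begin
        suc classes * length S                  ≤⟨ S≤ ⟩
        c + sum (map chosenEnds (e₀ ∷ τ))       ≤⟨ +-monoʳ-≤ c ends≤ ⟩
        c + (weight leafWeight (isSide (type l)) + weight leafWeight (isSide (type r)))
          ≡⟨ cong₂ (λ a b → c + (weight leafWeight a + weight leafWeight b))
               (trans (isSide-type l) (≡-sym leaf₀)) (trans (isSide-type r) (≡-sym leaf-M)) ⟩
        c + (w 0 + w M)                         ≡⟨ ≡-sym (+-assoc c (w 0) (w M)) ⟩
        c + w 0 + w M                           ≤⟨ +-monoˡ-≤ (w M) c≤ ⟩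
        total w (suc M)                         ∎)
      where open ≤-Reasoning

-- Finite sets: injections, sums and cardinalities.

-- A missed value could be punched out, giving an injection into a smaller finite set.
injective⇒preimage : ∀ {n} {f : Fin n → Fin n} → Injective _≡_ _≡_ f → ∀ y → ∃[ x ] f x ≡ y
injective⇒preimage {suc n} {f} inj y with Fin.any? (λ x → f x Fin.≟ y)
... | yes found = found
... | no  ¬found = contradiction
  (injective⇒≤ {f = λ x → punchOut (avoid x)} λ eq → inj (punchOut-injective (avoid _) (avoid _) eq)) 1+n≰n
  where
  avoid : ∀ x → y ≢ f x
  avoid x y≡fx = ¬found (x , ≡-sym y≡fx)

total-sum : ∀ w n → total w n ≡ sumᶠ {n} (w ∘ toℕ)
total-sum w zero    = refl
total-sum w (suc n) = ≡-sym (trans (sum-init-last (w ∘ toℕ)) (cong₂ _+_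
  (trans (sum-cong-≗ (cong w ∘ toℕ-inject₁ {n})) (≡-sym (total-sum w n))) (cong w (toℕ-fromℕ n))))

sum-weight₂ : ∀ {n} (b : Fin n → Bool) → sumᶠ (weight 2 ∘ b) ≡ n + ∣ tabulate b ∣
sum-weight₂ {zero}  b = refl
sum-weight₂ {suc n} b with b zero
... | true  = cong suc (trans (cong suc (sum-weight₂ (b ∘ suc))) (≡-sym (+-suc n _)))
... | false = cong suc (sum-weight₂ (b ∘ suc))

sum-weight₀ : ∀ {n} (b : Fin n → Bool) → sumᶠ (weight 0 ∘ b) + ∣ tabulate b ∣ ≡ n
sum-weight₀ {zero}  b = refl
sum-weight₀ {suc n} b with b zero
... | true  = trans (+-suc _ _) (cong suc (sum-weight₀ (b ∘ suc)))
... | false = cong suc (sum-weight₀ (b ∘ suc))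

∈-tabulate⁺ : ∀ {n} (f : Fin n → Bool) {x} → f x ≡ true → x ∈ₛ tabulate f
∈-tabulate⁺ f {x} fx = lookup⇒[]= x (tabulate f) (trans (lookup∘tabulate f x) fx)

∈-tabulate⁻ : ∀ {n} (f : Fin n → Bool) {x} → x ∈ₛ tabulate f → f x ≡ true
∈-tabulate⁻ f {x} x∈ = trans (≡-sym (lookup∘tabulate f x)) ([]=⇒lookup x∈)

∣p∣≥2 : ∀ {n} {p : Subset n} {x y} → x ∈ₛ p → y ∈ₛ p → x ≢ y → 2 ≤ ∣ p ∣
∣p∣≥2 x∈ y∈ x≢y = ≤-trans (s≤s (≤-trans (s≤s z≤n) (x∈p⇒∣p-x∣<∣p∣ (x∈p∧x≢y⇒x∈p-y x∈ x≢y)))) (x∈p⇒∣p-x∣<∣p∣ y∈)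

∣p∣≥3 : ∀ {n} {p : Subset n} {x y z} → x ∈ₛ p → y ∈ₛ p → z ∈ₛ p → x ≢ y → x ≢ z → y ≢ z → 3 ≤ ∣ p ∣
∣p∣≥3 x∈ y∈ z∈ x≢y x≢z y≢z = ≤-trans
  (s≤s (∣p∣≥2 (x∈p∧x≢y⇒x∈p-y x∈ x≢z) (x∈p∧x≢y⇒x∈p-y y∈ y≢z) x≢y)) (x∈p⇒∣p-x∣<∣p∣ z∈)

∣p∪q∣≤∣p∣+∣q∣ : ∀ {n} (p q : Subset n) → ∣ p ∪ₛ q ∣ ≤ ∣ p ∣ + ∣ q ∣
∣p∪q∣≤∣p∣+∣q∣ []            []            = z≤n
∣p∪q∣≤∣p∣+∣q∣ (outside ∷ p) (outside ∷ q) = ∣p∪q∣≤∣p∣+∣q∣ p q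
∣p∪q∣≤∣p∣+∣q∣ (outside ∷ p) (inside ∷ q)  = ≤-trans (s≤s (∣p∪q∣≤∣p∣+∣q∣ p q)) (≤-reflexive (≡-sym (+-suc _ _)))
∣p∪q∣≤∣p∣+∣q∣ (inside ∷ p)  (outside ∷ q) = s≤s (∣p∪q∣≤∣p∣+∣q∣ p q)
∣p∪q∣≤∣p∣+∣q∣ (inside ∷ p)  (inside ∷ q)  =
  s≤s (≤-trans (∣p∪q∣≤∣p∣+∣q∣ p q) (+-monoʳ-≤ ∣ p ∣ (n≤1+n ∣ q ∣)))

isDeg2-two : ∀ {d} → 2 ≤ d → d ≤ 2 → isDeg2 d ≡ true
isDeg2-two 2≤d d≤2 with refl ← ≤-antisym 2≤d d≤2 = refl

isDeg2-many : ∀ {d} → 3 ≤ d → isDeg2 d ≡ false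
isDeg2-many (s≤s (s≤s (s≤s _))) = refl

-- The polygon of a maximal outerplanar graph.

module Polygon {M : ℕ} (1<M : 1 < M) (G : Graph (suc M))
  (pos : Fin (suc M) → Fin (suc M))
  (polygon : ∀ u v → Side (suc M) (toℕ (pos u)) (toℕ (pos v)) → Adj G u v)
  (planar : ∀ u v x y → Adj G u v → Adj G x y →
    ¬ Cross (toℕ (pos u)) (toℕ (pos v)) (toℕ (pos x)) (toℕ (pos y)))
  (maximal : ∀ u v → u ≢ v → ¬ Adj G u v →
    ∃[ x ] ∃[ y ] (Adj G x y × Cross (toℕ (pos u)) (toℕ (pos v)) (toℕ (pos x)) (toℕ (pos y))))
  (q : ℕ → Fin (suc M)) (p-q : ∀ {x} → x < suc M → toℕ (pos (q x)) ≡ x) (q-p : ∀ v → q (toℕ (pos v)) ≡ v) where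

  p : Fin (suc M) → ℕ
  p v = toℕ (pos v)

  q-inj : ∀ {x y} → x < suc M → y < suc M → q x ≡ q y → x ≡ y
  q-inj x<N y<N eq = trans (≡-sym (p-q x<N)) (trans (cong p eq) (p-q y<N))

  -- The bounds belong to the relation because `q` is specified only on the corners up to `M`.
  A : ℕ → ℕ → Set
  A x y = x < suc M × y < suc M × Adj G (q x) (q y)

  A? : ∀ x y → Dec (A x y)
  A? x y = (x <? suc M) ×-dec (y <? suc M) ×-dec (adj G (q x) (q y) Bool.≟ true)

  A-sym : ∀ {x y} → A x y → A y x
  A-sym (x<N , y<N , a) = y<N , x<N , trans (Graph.sym G _ _) a

  A-irrefl : ∀ {x} → ¬ A x x
  A-irrefl (_ , _ , a) with () ← trans (≡-sym a) (irrfl G _)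

  A-bounded : ∀ {x y} → A x y → y ≤ M
  A-bounded (_ , s≤s y≤M , _) = y≤M

  Adj⇒A : ∀ {u v} → Adj G u v → A (p u) (p v)
  Adj⇒A {u} {v} a = toℕ<n (pos u) , toℕ<n (pos v) , subst₂ (Adj G) (≡-sym (q-p u)) (≡-sym (q-p v)) a

  uncrossed : ∀ {a b c d} → A a b → A c d → ¬ Cross a b c d
  uncrossed {a} {b} {c} {d} (a<N , b<N , ab) (c<N , d<N , cd) x =
    planar (q a) (q b) (q c) (q d) ab cd
      (subst₂ (λ a b → Cross a b (p (q c)) (p (q d))) (≡-sym (p-q a<N)) (≡-sym (p-q b<N))
        (subst₂ (Cross a b) (≡-sym (p-q c<N)) (≡-sym (p-q d<N)) x))

  between : ∀ {i j k} → i < k → k < j → Between i j k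
  between i<k k<j = subst (_< _) (≡-sym (m≤n⇒m⊓n≡m i≤j)) i<k , subst (_ <_) (≡-sym (m≤n⇒m⊔n≡n i≤j)) k<j
    where i≤j = <⇒≤ (<-trans i<k k<j)

  between⁻ : ∀ {i j k} → i < j → Between i j k → i < k × k < j
  between⁻ i<j (l , r) = subst (_< _) (m≤n⇒m⊓n≡m (<⇒≤ i<j)) l , subst (_ <_) (m≤n⇒m⊔n≡n (<⇒≤ i<j)) r

  outside⁻ : ∀ {i j k} → i < j → Outside i j k → k < i ⊎ j < k
  outside⁻ i<j (inj₁ l) = inj₁ (subst (_ <_) (m≤n⇒m⊓n≡m (<⇒≤ i<j)) l)
  outside⁻ i<j (inj₂ r) = inj₂ (subst (_< _) (m≤n⇒m⊔n≡n (<⇒≤ i<j)) r)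

  crossed : ∀ {a b} → a < b → b ≤ M → ¬ A a b → ∃[ c ] ∃[ d ] (A c d × (a < c × c < b) × (d < a ⊎ b < d))
  crossed {a} {b} a<b b≤M ¬ab
    with maximal (q a) (q b) (<⇒≢ a<b ∘ q-inj (<-trans a<b (s≤s b≤M)) (s≤s b≤M))
           (λ ab → ¬ab (<-trans a<b (s≤s b≤M) , s≤s b≤M , ab))
  ... | c , d , cd , x
    with subst₂ (λ a b → Cross a b (p c) (p d)) (p-q (<-trans a<b (s≤s b≤M))) (p-q (s≤s b≤M)) x
  ... | inj₁ (c-in , d-out) = p c , p d , Adj⇒A cd , between⁻ a<b c-in , outside⁻ a<b d-out
  ... | inj₂ (c-out , d-in) = p d , p c , A-sym (Adj⇒A cd) , between⁻ a<b d-in , outside⁻ a<b c-out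

  confined : ∀ {i k j y} → i < k → k < j → A i j → A k y → i ≤ y × y ≤ j
  confined {i} {k} {j} {y} i<k k<j ij ky =
    ≮⇒≥ (λ y<i → uncrossed ij ky (inj₁ (between i<k k<j , inj₁ (subst (_ <_) (≡-sym (m≤n⇒m⊓n≡m i≤j)) y<i)))) ,
    ≮⇒≥ (λ j<y → uncrossed ij ky (inj₁ (between i<k k<j , inj₂ (subst (_< _) (≡-sym (m≤n⇒m⊔n≡n i≤j)) j<y))))
    where i≤j = <⇒≤ (<-trans i<k k<j)

  A-side : ∀ {x} → suc x ≤ M → A x (suc x)
  A-side {x} x<M = x<N , s≤s x<M ,
    polygon (q x) (q (suc x)) (inj₁ (trans (cong suc (p-q x<N)) (≡-sym (p-q (s≤s x<M)))))
    where x<N = <-trans x<M (n<1+n M)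

  A-closing : A 0 M
  A-closing = s≤s z≤n , n<1+n M ,
    polygon (q 0) (q M) (inj₂ (inj₂ (inj₁ (p-q (s≤s z≤n) , cong suc (p-q (n<1+n M))))))

  open Chords A A-sym A-irrefl confined
  open Triangulation A? M A-bounded A-side crossed

  -- Corners of degree two.

  leaf? : ℕ → Bool
  leaf? x = isDeg2 (deg G (q x))

  A⇒∈ : ∀ {x y} → A x y → q y ∈ₛ tabulate (adj G (q x))
  A⇒∈ (_ , _ , a) = ∈-tabulate⁺ (adj G _) a

  A⇒q≢ : ∀ {x y z} → A z x → A z y → x ≢ y → q x ≢ q y
  A⇒q≢ (_ , x<N , _) (_ , y<N , _) x≢y = x≢y ∘ q-inj x<N y<N

  two-neighbours : ∀ {k x y} → A k x → A k y → x ≢ y → (∀ {z} → A k z → z ≡ x ⊎ z ≡ y) → leaf? k ≡ true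
  two-neighbours {k} {x} {y} kx ky x≢y only = isDeg2-two
    (∣p∣≥2 (A⇒∈ kx) (A⇒∈ ky) (A⇒q≢ kx ky x≢y))
    (≤-trans (p⊆q⇒∣p∣≤∣q∣ sub) (≤-trans (∣p∪q∣≤∣p∣+∣q∣ ⁅ q x ⁆ ⁅ q y ⁆)
      (≤-reflexive (cong₂ _+_ (∣⁅x⁆∣≡1 (q x)) (∣⁅x⁆∣≡1 (q y))))))
    where
    sub : tabulate (adj G (q k)) ⊆ₛ (⁅ q x ⁆ ∪ₛ ⁅ q y ⁆)
    sub {v} v∈
      with only {p v} (proj₁ kx , toℕ<n (pos v) , subst (Adj G (q k)) (≡-sym (q-p v)) (∈-tabulate⁻ (adj G (q k)) v∈))
    ... | inj₁ refl = p⊆p∪q _ (subst (_∈ₛ ⁅ q (p v) ⁆) (q-p v) (x∈⁅x⁆ _))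
    ... | inj₂ refl = q⊆p∪q ⁅ q x ⁆ _ (subst (_∈ₛ ⁅ q (p v) ⁆) (q-p v) (x∈⁅x⁆ _))

  three-neighbours : ∀ {k x y z} → A k x → A k y → A k z → x < y → y < z → leaf? k ≡ false
  three-neighbours kx ky kz x<y y<z = isDeg2-many (∣p∣≥3 (A⇒∈ kx) (A⇒∈ ky) (A⇒∈ kz)
    (A⇒q≢ kx ky (<⇒≢ x<y)) (A⇒q≢ kx kz (<⇒≢ (<-trans x<y y<z))) (A⇒q≢ ky kz (<⇒≢ y<z)))

  neighbour-before : ∀ {i k j} → A k i → suc i < k → A k j → k < j → leaf? k ≡ false
  neighbour-before {k = suc k} ki@(s≤s k<M , _) (s≤s i<k) kj k<j =
    three-neighbours ki (A-sym (A-side k<M)) kj i<k (<-trans (n<1+n k) k<j)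

  -- If both chords at `k` are sides, the edge `ij` confines its neighbours to `i` and `j`.
  -- Otherwise the corner next to `k` under a longer chord is a third neighbour.
  leaf-apex : ∀ {i k j} → A i j → (l : Tree i k) (r : Tree k j) → leaf? k ≡ isSideTree l ∧ isSideTree r
  leaf-apex {i} ij (side ik) (side kj) = two-neighbours (A-sym ik) kj (<⇒≢ (<-trans (n<1+n i) (n<1+n _))) only
    where
    only : ∀ {z} → A (suc i) z → z ≡ i ⊎ z ≡ suc (suc i)
    only kz with i≤z , z≤j ← confined (n<1+n i) (n<1+n _) ij kz with m≤n⇒m<n∨m≡n i≤z | m≤n⇒m<n∨m≡n z≤j
    ... | inj₂ refl | _ = inj₁ refl
    ... | inj₁ _ | inj₂ z≡j = inj₂ z≡j
    ... | inj₁ i<z | inj₁ z<j with refl ← ≤-antisym i<z (≤-pred z<j) = ⊥-elim (A-irrefl kz)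
  leaf-apex ij (side ik) r@(split kj r₁ r₂) =
    three-neighbours (A-sym ik) (A-side (<-≤-trans (ascending r) (A-bounded kj))) kj
      (<-trans (ascending (side ik)) (n<1+n _)) (≤-<-trans (ascending r₁) (ascending r₂))
  leaf-apex ij (split ik l₁ l₂) r =
    neighbour-before (A-sym ik) (≤-<-trans (ascending l₁) (ascending l₂)) (edge r) (ascending r)

  leaf-first : ∀ {k} (l : Tree 0 k) (r : Tree k M) → leaf? 0 ≡ isSideTree l
  leaf-first (side e) r = two-neighbours e A-closing (<⇒≢ (ascending r)) only
    where
    only : ∀ {z} → A 0 z → z ≡ 1 ⊎ z ≡ M
    only {zero} a = ⊥-elim (A-irrefl a)
    only {suc zero} _ = inj₁ refl
    only {suc (suc z)} a with m≤n⇒m<n∨m≡n (A-bounded a)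
    ... | inj₂ z≡M = inj₂ z≡M
    ... | inj₁ z<M with () ← proj₁ (confined (s≤s (s≤s z≤n)) z<M (edge r) (A-sym a))
  leaf-first l@(split _ l₁ l₂) r = three-neighbours (A-side (<⇒≤ 1<M)) (edge l) A-closing
    (≤-<-trans (ascending l₁) (ascending l₂)) (ascending r)

  -- Stated for a general `j` so that matching on `side` can set it to `suc k`.
  leaf-last : ∀ {k j} → A 0 j → (∀ {x y} → A x y → y ≤ j) → (l : Tree 0 k) (r : Tree k j) →
    leaf? j ≡ isSideTree r
  leaf-last {k} e bounded l (side kj) = two-neighbours (A-sym e) (A-sym kj) (<⇒≢ (ascending l)) only
    where
    only : ∀ {z} → A (suc k) z → z ≡ 0 ⊎ z ≡ k
    only {zero} _ = inj₁ refl
    only {suc z} a with m≤n⇒m<n∨m≡n (bounded a)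
    ... | inj₂ refl = ⊥-elim (A-irrefl a)
    ... | inj₁ z<j with m≤n⇒m<n∨m≡n (≤-pred z<j)
    ... | inj₂ z≡k = inj₂ z≡k
    ... | inj₁ z<k = ⊥-elim (1+n≰n (proj₂ (confined (s≤s z≤n) z<k (edge l) (A-sym a))))
  leaf-last e bounded l r@(split kj r₁ r₂) = last e kj (ascending l) (≤-<-trans (ascending r₁) (ascending r₂))
    where
    last : ∀ {k j} → A 0 j → A k j → 0 < k → suc k < j → leaf? j ≡ false
    last {j = suc j} e@(_ , s≤s j<M , _) kj 0<k (s≤s k<j) =
      three-neighbours (A-sym e) (A-sym kj) (A-sym (A-side j<M)) 0<k k<j

  -- From corners back to vertices.

  corners : List ℕ → Subset (suc M)
  corners = foldr (λ x S → ⁅ q x ⁆ ∪ₛ S) ⊥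

  ∣corners∣ : ∀ S → ∣ corners S ∣ ≤ length S
  ∣corners∣ []      = ≤-reflexive (∣⊥∣≡0 (suc M))
  ∣corners∣ (x ∷ S) = ≤-trans (∣p∪q∣≤∣p∣+∣q∣ ⁅ q x ⁆ (corners S))
    (+-mono-≤ (≤-reflexive (∣⁅x⁆∣≡1 (q x))) (∣corners∣ S))

  ∈-corners : ∀ {x S} → x ∈ S → q x ∈ₛ corners S
  ∈-corners (here refl) = p⊆p∪q _ (x∈⁅x⁆ _)
  ∈-corners {S = y ∷ _} (there x∈) = q⊆p∪q ⁅ q y ⁆ _ (∈-corners x∈)

  -- With `U` the complement of the closed neighbourhood, the centre of an undominated path on three
  -- vertices would have two neighbours in `U`.
  corners-isolating : ∀ {S} → Isolates 0 M S → IsK12Isolating G (corners S)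
  corners-isolating {S} iso u v w u≢w uv vw (¬u , ¬v , ¬w) = u≢w (trans (≡-sym (q-p u)) (trans (cong q pu≡pw) (q-p w)))
    where
    U : ℕ → Set
    U x = ¬ InN G (corners S) (q x)
    kills : ∀ x → x ∈ S → Kills U x
    kills x x∈ = (λ ¬x → ¬x (inj₁ (∈-corners x∈))) ,
      λ y (_ , _ , xy) ¬y → ¬y (inj₂ (q x , ∈-corners x∈ , xy))
    back : ∀ {v} → ¬ InN G (corners S) v → U (p v)
    back {v} = subst (λ v → ¬ InN G (corners S) v) (≡-sym (q-p v))
    pu≡pw : p u ≡ p w
    pu≡pw = iso U kills (p v) z≤n (≤-pred (toℕ<n (pos v))) (back ¬v) (p u) (p w)
      (back ¬u , A-sym (Adj⇒A uv)) (back ¬w , Adj⇒A vw)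

  corner : Permutation (suc M) (suc M)
  corner = permutation (q ∘ toℕ) pos q-p (λ x → toℕ-injective (p-q (toℕ<n x)))

  total-corners : ∀ (f : Fin (suc M) → ℕ) → total (f ∘ q) (suc M) ≡ sumᶠ f
  total-corners f = trans (total-sum (f ∘ q) (suc M)) (≡-sym (sum-permute f corner))

  module Bound (σ : Scheme) where
    open Scheme σ
    open Induction leaf? leaf-apex σ public using (type; isolate)

    bound : (∀ {k} (l : Tree 0 k) (r : Tree k M) → T (closesAt (type l) (type r))) →
      ∃[ S ] (IsK12Isolating G S × suc classes * ∣ S ∣ ≤ sumᶠ (weight leafWeight ∘ isDeg2 ∘ deg G))
    bound adm
      with k , 0<k , k<M , e₁ , e₂ ← apex 1<M A-closing
      with l ← triangulate M 0<k (<⇒≤ k<M) e₁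
      with r ← triangulate M k<M (m≤n+m M k) e₂
      with S , iso , S≤ ← isolate l r A-closing A-bounded (leaf-first l r) (leaf-last A-closing A-bounded l r) (adm l r) =
      corners S , corners-isolating iso , (begin
        suc classes * ∣ corners S ∣ ≤⟨ *-monoʳ-≤ (suc classes) (∣corners∣ S) ⟩
        suc classes * length S      ≤⟨ S≤ ⟩
        _                           ≡⟨ total-corners (weight leafWeight ∘ isDeg2 ∘ deg G) ⟩
        _                           ∎)
      where open ≤-Reasoning

  -- Small polygons excluded, and the two bounds.

  -- The pairs rejected by `closesAt₃` come from a triangle or a quadrilateral, where `j` is at most
  -- 3. This uses the full strength of `n ≥ 5`.
  closes₃ : ∀ {k j} (l : Tree 0 k) (r : Tree k j) → 4 ≤ j →
    T (closesAt₃ (Bound.type scheme₃ l) (Bound.type scheme₃ r))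
  closes₃ (side _) (side _)                                 (s≤s (s≤s ()))
  closes₃ (side _) (split _ (side _) (side _))              (s≤s (s≤s (s≤s ())))
  closes₃ (side _) (split _ (side _) (split _ _ _))         _ = _
  closes₃ (side _) (split _ (split _ _ _) _)                _ = _
  closes₃ (split _ (side _) (side _)) (side _)              (s≤s (s≤s (s≤s ())))
  closes₃ (split _ (side _) (split _ _ _)) (side _)         _ = _
  closes₃ (split _ (split _ _ _) _) (side _)                _ = _
  closes₃ (split _ _ _) (split _ _ _)                       _ = _

theorem1p3 : (n : ℕ) → n ≥ 5 → (G : Graph n) → IsMOP G →
    (3 * n₂ G ≤ n → ∃[ S ] (IsK12Isolating G S × 6 * ∣ S ∣ ≤ n + n₂ G)) ×
    (3 * n₂ G > n → ∃[ S ] (IsK12Isolating G S × 3 * ∣ S ∣ + n₂ G ≤ n))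
theorem1p3 (suc M) (s≤s 4≤M) G (pos , pos-inj , polygon , planar , maximal) = (λ _ → first) , (λ _ → second)
  where
  q : ℕ → Fin (suc M)
  -- The reduction modulo `suc M` merely gives `q` a value beyond the last corner.
  q x = proj₁ (injective⇒preimage pos-inj (x mod suc M))
  p-q : ∀ {x} → x < suc M → toℕ (pos (q x)) ≡ x
  p-q {x} x<N = trans (cong toℕ (proj₂ (injective⇒preimage pos-inj (x mod suc M))))
    (trans (toℕ-fromℕ< _) (m<n⇒m%n≡m x<N))
  q-p : ∀ v → q (toℕ (pos v)) ≡ v
  q-p v = pos-inj (toℕ-injective (p-q (toℕ<n (pos v))))
  open Polygon (≤-trans (s≤s (s≤s z≤n)) 4≤M) G pos polygon planar maximal q p-q q-p
  degree2 = isDeg2 ∘ deg G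
  first : ∃[ S ] (IsK12Isolating G S × 6 * ∣ S ∣ ≤ suc M + n₂ G)
  first = map₂ (map₂ λ S≤ → ≤-trans S≤ (≤-reflexive (sum-weight₂ degree2))) (Bound.bound scheme₆ _)
  second : ∃[ S ] (IsK12Isolating G S × 3 * ∣ S ∣ + n₂ G ≤ suc M)
  second = map₂ (map₂ λ S≤ → ≤-trans (+-monoˡ-≤ (n₂ G) S≤) (≤-reflexive (sum-weight₀ degree2)))
    (Bound.bound scheme₃ λ l r → closes₃ l r 4≤M)
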